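{- Let $D$ be a partial layer decomposition (PLD) of a DAG $G=(V,A)$. Let $X\in V$ be a boundary variable of $\mathrm{Vars}(D)$. Then there exist at most two unique (i.e. distinct) insertions of $X$ into $D$.
   Context: All graphs are finite. A layer decomposition of a DAG $G=(V,A)$ is a list $((T^0,S^0),\dots,(T^k,S^k))$ of pairs of subsets of $V$ such that: (D1) $(T^0,\dots,T^k)$ is an ordered partition of $V$ (into nonempty blocks); (D2) $S^i\subseteq T^i$ for every $i\in\{0,\dots,k\}$; (D3) for every $i\in\{0,\dots,k-1\}$, no two variables $X\in T^0\cup\dots\cup T^{i-1}\cup(T^i\setminus S^i)$ and $Y\in T^{i+1}\cup\dots\cup T^k$ are connected by an arrow in $G$; (D4) for every $i\in\{1,\dots,k\}$, every child in $G$ of a variable in $S^i$ belongs to $(T^i\setminus S^i)\cup S^{i-1}$, and every child of a variable in $S^0$ belongs to $T^0\setminus S^0$; (D5) for every $i\in\{0,\dots,k-1\}$, every parent in $G$ of a variable in $S^i$ belongs to $T^{i+1}$, and no variable in $S^k$ has a parent. For $W\subseteq V$, $G[W]$ is the subgraph of $G$ induced on $W$. A partial layer decomposition (PLD) $D$ of $G$ is a layer decomposition of $G[W]$ for some $W\subseteq V$; then $\mathrm{Vars}(D)=W$. Let $D=((T_1^0,S_1^0),\dots,(T_1^k,S_1^k))$ and $D'=((T_2^0,S_2^0),\dots,(T_2^j,S_2^j))$ be PLDs of $G$ with $\mathrm{Vars}(D')\subseteq\mathrm{Vars}(D)$. $D'$ is a sub-PLD of $D$ iff there is a non-negative integer $m$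 such that for all $i\in\{0,\dots,j\}$: $T_2^i\subseteq T_1^{i+m}$, $S_2^i\subseteq S_1^{i+m}$ and $T_2^i\setminus S_2^i\subseteq T_1^{i+m}\setminus S_1^{i+m}$. For a PLD $D$ of $G$ and $X\in V\setminus\mathrm{Vars}(D)$, an insertion of $X$ into $D$ is a PLD $D'$ of $G$ with $\mathrm{Vars}(D')=\mathrm{Vars}(D)\cup\{X\}$ such that $D$ is a sub-PLD of $D'$. For $W\subseteq V$, a boundary variable of $W$ is a variable $X\in V\setminus W$ such that some parent or child of $X$ in $G$ belongs to $W$. -}

module Defs where

open import Level using (0ℓ)
open import Data.Nat using (ℕ; suc; _+_)
open import Data.Fin using (Fin; zero; suc; toℕ; fromℕ; inject₁; _<_)
open import Data.Fin.Subset using (Subset; _∈_; _∉_; _⊆_; _─_; _∪_; ⁅_⁆; Nonempty)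
open import Data.Product using (∃; ∃-syntax; _×_; _,_; proj₁; proj₂)
open import Data.Sum using (_⊎_)
open import Data.Vec using (Vec; lookup)
open import Relation.Binary.Core using (Rel)
open import Relation.Binary.Construct.Closure.Transitive using (TransClosure; [_]; _∷_)
open import Relation.Binary.PropositionalEquality using (_≡_)
open import Relation.Nullary using (¬_)

private
  variable
    n : ℕ

-- The vertex set is a subset of the ambient set Fin n (rather than all of
-- Fin n), so that an induced subgraph is again a graph of the same type.
record DAG (n : ℕ) : Set₁ where
  infix 4 _⟶_
  field
    V       : Subset n
    _⟶_     : Rel (Fin n) 0ℓ
    source∈ : ∀ {x y} → x ⟶ y → x ∈ V
    target∈ : ∀ {x y} → x ⟶ y → y ∈ V
    acyclic : ∀ x → ¬ TransClosure _⟶_ x x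

induced : (G : DAG n) (W : Subset n) → W ⊆ DAG.V G → DAG n
induced {n} G W _ = record
  { V       = W
  ; _⟶_     = _⟶W_
  ; source∈ = λ (_ , x∈W , _) → x∈W
  ; target∈ = λ (_ , _ , y∈W) → y∈W
  ; acyclic = λ x p → acyclic x (forget p)
  }
  where
  open DAG G
  _⟶W_ : Rel (Fin n) 0ℓ
  x ⟶W y = x ⟶ y × x ∈ W × y ∈ W
  forget : ∀ {x y} → TransClosure _⟶W_ x y → TransClosure _⟶_ x y
  forget [ a ]   = [ proj₁ a ]
  forget (a ∷ p) = proj₁ a ∷ forget p

-- A list ((T⁰,S⁰),…,(Tᵏ,Sᵏ)).
record Layers (n : ℕ) : Set where
  constructor mkLayers
  field
    k     : ℕ
    pairs : Vec (Subset n × Subset n) (suc k)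

  T S : Fin (suc k) → Subset n
  T i = proj₁ (lookup pairs i)
  S i = proj₂ (lookup pairs i)

-- An index i : Fin k ranges over {0,…,k-1}; as elements of {0,…,k},
-- inject₁ i is i, suc i is i+1 and fromℕ k is k.
record IsLayerDecomposition (G : DAG n) (L : Layers n) : Set where
  open DAG G
  open Layers L
  field
    T-nonempty : ∀ i → Nonempty (T i)
    T-disjoint : ∀ {x} i j → x ∈ T i → x ∈ T j → i ≡ j
    T⊆V        : ∀ i → T i ⊆ V
    T-covers   : ∀ {x} → x ∈ V → ∃[ i ] x ∈ T i
    S⊆T : ∀ i → S i ⊆ T i
    separated : ∀ (i : Fin k) {x y} →
      (∃[ j ] (j < inject₁ i × x ∈ T j)) ⊎ x ∈ T (inject₁ i) ─ S (inject₁ i) →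
      ∃[ j ] (inject₁ i < j × y ∈ T j) →
      ¬ (x ⟶ y ⊎ y ⟶ x)
    S-children : ∀ (i : Fin k) {x y} → x ∈ S (suc i) → x ⟶ y →
      y ∈ T (suc i) ─ S (suc i) ⊎ y ∈ S (inject₁ i)
    S⁰-children : ∀ {x y} → x ∈ S zero → x ⟶ y → y ∈ T zero ─ S zero
    S-parents : ∀ (i : Fin k) {x y} → x ∈ S (inject₁ i) → y ⟶ x → y ∈ T (suc i)
    Sᵏ-parents : ∀ {x y} → x ∈ S (fromℕ k) → ¬ (y ⟶ x)

-- Two PLDs are the same when their layers are equal; the remaining fields
-- are determined by the layers or are proofs.
record PLD (G : DAG n) : Set where
  field
    Vars          : Subset n
    Vars⊆V        : Vars ⊆ DAG.V G
    layers        : Layers n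
    decomposition : IsLayerDecomposition (induced G Vars Vars⊆V) layers

  open Layers layers public

infix 4 _IsSubPLDOf_

_IsSubPLDOf_ : {G : DAG n} → PLD G → PLD G → Set
D′ IsSubPLDOf D =
  D′.Vars ⊆ D.Vars ×
  ∃[ m ] ∀ (i : Fin (suc D′.k)) → ∃[ i+m ] (
    toℕ i+m ≡ toℕ i + m ×
    D′.T i ⊆ D.T i+m ×
    D′.S i ⊆ D.S i+m ×
    D′.T i ─ D′.S i ⊆ D.T i+m ─ D.S i+m)
  where
  module D  = PLD D
  module D′ = PLD D′

IsInsertion : {G : DAG n} (X : Fin n) (D D′ : PLD G) → Set
IsInsertion X D D′ = PLD.Vars D′ ≡ PLD.Vars D ∪ ⁅ X ⁆ × D IsSubPLDOf D′

record IsBoundary (G : DAG n) (W : Subset n) (X : Fin n) : Set where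
  open DAG G
  field
    X∈V      : X ∈ V
    X∉W      : X ∉ W
    adjacent : ∃[ Y ] (Y ∈ W × (Y ⟶ X ⊎ X ⟶ Y))

{-# OPTIONS --safe #-}
-- In a layer decomposition an arrow x ⟶ y with y in layer b starts in layer
-- b + 1 if y ∈ Sᵇ and in layer b otherwise.  Hence, relative to the layers of
-- D, the layer of X in an insertion is determined by a neighbour of X in
-- Vars(D) and by the answer to the question whether X lies in the S-part of
-- its layer.  This layer and this answer determine the insertion, so there
-- are at most two.
module Submission where

open import Defs
open import Data.Fin using (Fin; zero; suc; toℕ; fromℕ; inject₁; _<_)
open import Data.Fin.Properties
  using (toℕ-injective; toℕ-inject₁; toℕ-fromℕ; toℕ≤pred[n]; <-cmp; ≤fromℕ)
open import Data.Fin.Relation.Unary.Top using (view; ‵fromℕ; ‵inject₁)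
open import Data.Fin.Subset
  using (Subset; Side; inside; outside; _∈_; _∉_; _⊆_; _─_; ⁅_⁆)
open import Data.Fin.Subset.Properties
  using (x∈p∧x∉q⇒x∈p─q; p─q⊆p; x∈p∪q⁻; x∈p∪q⁺; x∈⁅x⁆; x∈⁅y⁆⇒x≡y; ⊆-antisym)
open import Data.Nat using (ℕ; suc; _+_; _≤_)
open import Data.Nat.Properties
  using (+-assoc; +-cancelˡ-≡; +-cancelʳ-≡; +-commutativeSemigroup; m+n≡0⇒n≡0; ≤-antisym; <⇒≱)
open import Algebra.Properties.CommutativeSemigroup +-commutativeSemigroup using (xy∙z≈xz∙y)
open import Data.Product using (∃-syntax; _×_; _,_; proj₁; proj₂)
open import Data.Sum using (_⊎_; inj₁; inj₂)
open import Data.Vec using (Vec; _∷_; lookup; _[_]=_; here; there)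
open import Data.Vec.Properties using ([]=-injective; lookup⇒[]=)
open import Data.Vec.Relation.Binary.Pointwise.Extensional using (ext; Pointwise-≡⇒≡)
open import Relation.Binary.Definitions using (tri<; tri≈; tri>)
open import Relation.Binary.PropositionalEquality
  using (_≡_; refl; sym; trans; cong; cong₂; subst; module ≡-Reasoning)
open import Relation.Nullary using (¬_; contradiction)

private
  variable
    n : ℕ

-- Layer and side of a vertex

outside⇒∉ : ∀ {p : Subset n} {x} → p [ x ]= outside → x ∉ p
outside⇒∉ x-out x-in = contradiction ([]=-injective x-out x-in) λ ()

x∈p─q⇒outside : ∀ (p q : Subset n) {x} → x ∈ p ─ q → q [ x ]= outside
x∈p─q⇒outside (_ ∷ p) (outside ∷ q) here         = here
x∈p─q⇒outside (_ ∷ p) (inside  ∷ q) (there x∈─) = there (x∈p─q⇒outside p q x∈─)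
x∈p─q⇒outside (_ ∷ p) (outside ∷ q) (there x∈─) = there (x∈p─q⇒outside p q x∈─)

-- The layer index is a natural number, so positions in lists of different lengths can be compared
-- and shifted. The side tells the S-part from the rest of the layer.
Placed : Layers n → Fin n → Side → ℕ → Set
Placed L x s a = ∃[ i ] (toℕ i ≡ a × x ∈ T i × S i [ x ]= s)
  where open Layers L

∈T⇒Placed : ∀ (L : Layers n) {x} i → x ∈ Layers.T L i → ∃[ s ] Placed L x s (toℕ i)
∈T⇒Placed L {x} i x∈T = _ , i , refl , x∈T , lookup⇒[]= x (Layers.S L i) refl

-- The number of layers that an arrow descends, as a function of the side of its target.
rise : Side → ℕ
rise inside  = 1
rise outside = 0

-- Arrows and layers in one decomposition

module _ {G : DAG n} {L : Layers n} (dec : IsLayerDecomposition G L) where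
  open DAG G
  open Layers L
  open IsLayerDecomposition dec

  Placed-unique : ∀ {x s t a b} → Placed L x s a → Placed L x t b → s ≡ t × a ≡ b
  Placed-unique (i , refl , x∈Tᵢ , x-s) (j , refl , x∈Tⱼ , x-t)
    with refl ← T-disjoint i j x∈Tᵢ x∈Tⱼ = []=-injective x-s x-t , refl

  Placed-exists : ∀ {x} → x ∈ V → ∃[ s ] ∃[ a ] Placed L x s a
  Placed-exists x∈V with i , x∈T ← T-covers x∈V with s , p ← ∈T⇒Placed L i x∈T = s , _ , p

  Placed⇒∈V : ∀ {x s a} → Placed L x s a → x ∈ V
  Placed⇒∈V (i , _ , x∈T , _) = T⊆V i x∈T

  -- A layer with another one above it is not the top one, so its index has the form `inject₁ i′`
  -- that `separated` asks for.
  rest-separated : ∀ {i j x y} → i < j → x ∈ T i ─ S i → y ∈ T j → ¬ (x ⟶ y ⊎ y ⟶ x)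
  rest-separated {i} {j} i<j x∈ y∈ with view i
  ... | ‵fromℕ      = contradiction (≤fromℕ j) (<⇒≱ i<j)
  ... | ‵inject₁ i′ = separated i′ (inj₂ x∈) (j , i<j , y∈)

  parent-of-S : ∀ {i j x y} → x ∈ T i → y ∈ S j → x ⟶ y → toℕ i ≡ suc (toℕ j)
  parent-of-S {i} {j} x∈ y∈ x⟶y with view j
  ... | ‵fromℕ      = contradiction x⟶y (Sᵏ-parents y∈)
  ... | ‵inject₁ j′ = trans (cong toℕ (T-disjoint i (suc j′) x∈ (S-parents j′ y∈ x⟶y)))
                            (cong suc (sym (toℕ-inject₁ j′)))

  -- `S-children` would also allow the child in the S-part one layer down, but `y ∉ S j` rules this
  -- out.
  S-parent-of-rest : ∀ {i j x y} → x ∈ S i → y ∈ T j → y ∉ S j → x ⟶ y → i ≡ j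
  S-parent-of-rest {zero} {j} x∈ y∈ y∉ x⟶y =
    T-disjoint zero j (p─q⊆p _ _ (S⁰-children x∈ x⟶y)) y∈
  S-parent-of-rest {suc i} {j} x∈ y∈ y∉ x⟶y with S-children i x∈ x⟶y
  ... | inj₁ y∈─ = T-disjoint (suc i) j (p─q⊆p _ _ y∈─) y∈
  ... | inj₂ y∈S with refl ← T-disjoint (inject₁ i) j (S⊆T _ y∈S) y∈ = contradiction y∈S y∉

  rest-parent-of-rest : ∀ {i j x y} → x ∈ T i ─ S i → y ∈ T j ─ S j → x ⟶ y → i ≡ j
  rest-parent-of-rest {i} {j} x∈ y∈ x⟶y with <-cmp i j
  ... | tri< i<j _ _ = contradiction (inj₁ x⟶y) (rest-separated i<j x∈ (p─q⊆p _ _ y∈))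
  ... | tri≈ _ i≡j _ = i≡j
  ... | tri> _ _ j<i = contradiction (inj₂ x⟶y) (rest-separated j<i y∈ (p─q⊆p _ _ x∈))

  -- A target in an S-part is governed by the conditions on parents. For any other target, the side
  -- of the source decides between the conditions on children and the separation of layers.
  arrow-rise : ∀ {x y s t a b} → Placed L x s a → Placed L y t b → x ⟶ y → a ≡ rise t + b
  arrow-rise {t = inside} (_ , refl , x∈ , _) (_ , refl , _ , y∈S) x⟶y =
    parent-of-S x∈ y∈S x⟶y
  arrow-rise {s = inside} {t = outside} (_ , refl , _ , x∈S) (_ , refl , y∈ , y-out) x⟶y =
    cong toℕ (S-parent-of-rest x∈S y∈ (outside⇒∉ y-out) x⟶y)
  arrow-rise {s = outside} {t = outside} (_ , refl , x∈ , x-out) (_ , refl , y∈ , y-out) x⟶y =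
    cong toℕ (rest-parent-of-rest (x∈p∧x∉q⇒x∈p─q x∈ (outside⇒∉ x-out))
                                  (x∈p∧x∉q⇒x∈p─q y∈ (outside⇒∉ y-out)) x⟶y)

-- Recovering layer lists from placements

infix 4 _≼_

_≼_ : Layers n → Layers n → Set
L₁ ≼ L₂ = ∀ {y s a} → Placed L₁ y s a → Placed L₂ y s a

-- A vertex of the nonempty top layer of `L₁` has the same position in `L₂`, so `L₂` reaches at
-- least that high.
≼⇒k≤k : ∀ (L₁ L₂ : Layers n) → L₁ ≼ L₂ → (∀ i → ∃[ x ] x ∈ Layers.T L₁ i) →
  Layers.k L₁ ≤ Layers.k L₂
≼⇒k≤k L₁ L₂ L₁≼L₂ nonempty
  with x , x∈ ← nonempty (fromℕ (Layers.k L₁))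
  with s , p ← ∈T⇒Placed L₁ (fromℕ (Layers.k L₁)) x∈
  with i , i≡ , _ ← L₁≼L₂ p
  = subst (_≤ Layers.k L₂) (trans i≡ (toℕ-fromℕ (Layers.k L₁))) (toℕ≤pred[n] i)

module _ {k} (ps qs : Vec (Subset n × Subset n) (suc k))
         (ps≼qs : mkLayers k ps ≼ mkLayers k qs) where

  ≼⇒T⊆T : ∀ i → proj₁ (lookup ps i) ⊆ proj₁ (lookup qs i)
  ≼⇒T⊆T i x∈
    with s , p ← ∈T⇒Placed (mkLayers _ ps) i x∈
    with j , j≡ , x∈′ , _ ← ps≼qs p
    with refl ← toℕ-injective j≡ = x∈′

  ≼⇒S⊆S : (∀ i → proj₂ (lookup ps i) ⊆ proj₁ (lookup ps i)) →
    ∀ i → proj₂ (lookup ps i) ⊆ proj₂ (lookup qs i)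
  ≼⇒S⊆S S⊆T i x∈
    with j , j≡ , _ , x∈′ ← ps≼qs (i , refl , S⊆T i x∈ , x∈)
    with refl ← toℕ-injective j≡ = x∈′

-- Two graphs are allowed because each insertion induces a graph on its own `Vars`.
≼-antisym : ∀ {G₁ G₂ : DAG n} {L₁ L₂ : Layers n} →
  IsLayerDecomposition G₁ L₁ → IsLayerDecomposition G₂ L₂ → L₁ ≼ L₂ → L₂ ≼ L₁ → L₁ ≡ L₂
≼-antisym {L₁ = L₁@(mkLayers k ps)} {L₂@(mkLayers _ qs)} dec₁ dec₂ L₁≼L₂ L₂≼L₁
  -- The lengths are identified first, so that `ps` and `qs` have one type and can be compared entry
  -- by entry.
  with refl ← ≤-antisym (≼⇒k≤k L₁ L₂ L₁≼L₂ (IsLayerDecomposition.T-nonempty dec₁))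
                        (≼⇒k≤k L₂ L₁ L₂≼L₁ (IsLayerDecomposition.T-nonempty dec₂))
  = cong (mkLayers k) (Pointwise-≡⇒≡ (ext λ i → cong₂ _,_
      (⊆-antisym (≼⇒T⊆T ps qs L₁≼L₂ i) (≼⇒T⊆T qs ps L₂≼L₁ i))
      (⊆-antisym (≼⇒S⊆S ps qs L₁≼L₂ (S⊆T dec₁) i) (≼⇒S⊆S qs ps L₂≼L₁ (S⊆T dec₂) i))))
  where open IsLayerDecomposition

-- Placements in a single insertion

module _ {G : DAG n} {D D′ : PLD G} where
  private
    module D  = PLD D
    module D′ = PLD D′

  -- The inclusion of S-parts preserves the side `inside`; the inclusion of the differences
  -- preserves `outside`.
  Placed-shift : (sub : D IsSubPLDOf D′) → ∀ {y s a} →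
    Placed D.layers y s a → Placed D′.layers y s (a + proj₁ (proj₂ sub))
  Placed-shift (_ , m , embeds) {s = inside} (i , refl , y∈ , y∈S)
    with j , j≡ , T⊆ , S⊆ , _ ← embeds i = j , j≡ , T⊆ y∈ , S⊆ y∈S
  Placed-shift (_ , m , embeds) {s = outside} (i , refl , y∈ , y-out)
    with j , j≡ , T⊆ , _ , R⊆ ← embeds i =
    j , j≡ , T⊆ y∈ ,
    x∈p─q⇒outside (D′.T j) (D′.S j) (R⊆ (x∈p∧x∉q⇒x∈p─q y∈ (outside⇒∉ y-out)))

record Insertion {G : DAG n} (X : Fin n) (D : PLD G) : Set where
  constructor insertion
  field
    pld         : PLD G
    isInsertion : IsInsertion X D pld

  private
    module D  = PLD D
    module D′ = PLD pld
    open IsLayerDecomposition D′.decomposition using (T-nonempty; T⊆V)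
    sub : D IsSubPLDOf pld
    sub = proj₂ isInsertion

  layers : Layers n
  layers = D′.layers

  decomposition : IsLayerDecomposition (induced G D′.Vars D′.Vars⊆V) layers
  decomposition = D′.decomposition

  shift : ℕ
  shift = proj₁ (proj₂ sub)

  embed : ∀ {y s a} → Placed D.layers y s a → Placed layers y s (a + shift)
  embed = Placed-shift {D = D} {pld} sub

  X∈Vars : X ∈ D′.Vars
  X∈Vars = subst (X ∈_) (sym (proj₁ isInsertion)) (x∈p∪q⁺ (inj₂ (x∈⁅x⁆ X)))

  old-or-X : ∀ {y} → y ∈ D′.Vars → y ∈ D.Vars ⊎ y ≡ X
  old-or-X y∈ with x∈p∪q⁻ D.Vars ⁅ X ⁆ (subst (_ ∈_) (proj₁ isInsertion) y∈)
  ... | inj₁ y∈D = inj₁ y∈D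
  ... | inj₂ y∈X = inj₂ (x∈⁅y⁆⇒x≡y X y∈X)

  Placed-X : ∃[ s ] ∃[ a ] Placed layers X s a
  Placed-X = Placed-exists decomposition X∈Vars

  -- If D is shifted up, the nonempty layer 0 can contain only X.
  unshifted-or-X-bottom : ∀ {s a} → Placed layers X s a → shift ≡ 0 ⊎ a ≡ 0
  unshifted-or-X-bottom X-at
    with y , y∈ ← T-nonempty zero
    with t , y-at ← ∈T⇒Placed layers zero y∈
    with old-or-X (T⊆V zero y∈)
  ... | inj₂ refl = inj₂ (proj₂ (Placed-unique decomposition X-at y-at))
  ... | inj₁ y∈D
    with _ , b , y-old ← Placed-exists D.decomposition y∈D =
    inj₁ (m+n≡0⇒n≡0 b (proj₂ (Placed-unique decomposition (embed y-old) y-at)))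

  -- Here `X` is the target, so the descent depends on the side of `X`; in `arrow-from-X` it depends
  -- on the side of `Y`, which `D` fixes.
  arrow-to-X : ∀ {Y s t a b} → Placed D.layers Y t b → Placed layers X s a →
    DAG._⟶_ G Y X → b + shift ≡ rise s + a
  arrow-to-X Y-at X-at Y⟶X = arrow-rise decomposition (embed Y-at) X-at
    (Y⟶X , Placed⇒∈V decomposition (embed Y-at) , X∈Vars)

  arrow-from-X : ∀ {Y s t a b} → Placed D.layers Y t b → Placed layers X s a →
    DAG._⟶_ G X Y → a ≡ rise t + b + shift
  arrow-from-X {t = t} {b = b} Y-at X-at X⟶Y = trans
    (arrow-rise decomposition X-at (embed Y-at)
      (X⟶Y , X∈Vars , Placed⇒∈V decomposition (embed Y-at)))
    (sym (+-assoc (rise t) b shift))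

-- The equation says that the integers `a₁ - m₁` and `a₂ - m₂` agree. As one of `a` and `m` vanishes
-- in each pair, `m` is the negative part of this common difference.
equal-shifts : ∀ {a₁ a₂ m₁ m₂} → a₁ + m₂ ≡ a₂ + m₁ →
  m₁ ≡ 0 ⊎ a₁ ≡ 0 → m₂ ≡ 0 ⊎ a₂ ≡ 0 → m₁ ≡ m₂
equal-shifts eq (inj₁ refl) (inj₁ refl) = refl
equal-shifts {a₁} eq (inj₁ refl) (inj₂ refl) = sym (m+n≡0⇒n≡0 a₁ eq)
equal-shifts {a₂ = a₂} eq (inj₂ refl) (inj₁ refl) = m+n≡0⇒n≡0 a₂ (sym eq)
equal-shifts eq (inj₂ refl) (inj₂ refl) = sym eq

side-pigeonhole : ∀ (s t u : Side) → s ≡ t ⊎ s ≡ u ⊎ t ≡ u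
side-pigeonhole inside  inside  _       = inj₁ refl
side-pigeonhole outside outside _       = inj₁ refl
side-pigeonhole inside  outside inside  = inj₂ (inj₁ refl)
side-pigeonhole outside inside  outside = inj₂ (inj₁ refl)
side-pigeonhole inside  outside outside = inj₂ (inj₂ refl)
side-pigeonhole outside inside  inside  = inj₂ (inj₂ refl)

-- Comparing insertions

module _ {G : DAG n} {X : Fin n} {D : PLD G} where

  -- Apart from `X`, every vertex comes from `D`, and its position is its position in `D` plus the
  -- shift.
  placement-determines-≼ :
    (I₁ I₂ : Insertion X D) →
    Insertion.shift I₁ ≡ Insertion.shift I₂ → ∀ {s a} →
    Placed (Insertion.layers I₁) X s a → Placed (Insertion.layers I₂) X s a →
    Insertion.layers I₁ ≼ Insertion.layers I₂
  placement-determines-≼ I₁ I₂ m₁≡m₂ X-at₁ X-at₂ y-at₁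
    with Insertion.old-or-X I₁ (Placed⇒∈V (Insertion.decomposition I₁) y-at₁)
  ... | inj₂ refl
    with refl , refl ← Placed-unique (Insertion.decomposition I₁) y-at₁ X-at₁ = X-at₂
  ... | inj₁ y∈D
    with _ , b , y-at ← Placed-exists (PLD.decomposition D) y∈D
    with refl , refl ← Placed-unique (Insertion.decomposition I₁) y-at₁ (Insertion.embed I₁ y-at)
    = subst (λ m → Placed (Insertion.layers I₂) _ _ (b + m)) (sym m₁≡m₂) (Insertion.embed I₂ y-at)

  -- The position of `X` relative to `D` is read off from one neighbour `Y`. The additive form
  -- avoids truncated subtraction.
  same-side⇒same-offset : IsBoundary G (PLD.Vars D) X →
    (I₁ I₂ : Insertion X D) → ∀ {s a₁ a₂} →
    Placed (Insertion.layers I₁) X s a₁ → Placed (Insertion.layers I₂) X s a₂ →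
    a₁ + Insertion.shift I₂ ≡ a₂ + Insertion.shift I₁
  same-side⇒same-offset boundary I₁ I₂ {s} {a₁} {a₂} X-at₁ X-at₂
    with Y , Y∈D , adjacent ← IsBoundary.adjacent boundary
    with t , b , Y-at ← Placed-exists (PLD.decomposition D) Y∈D
    with adjacent
  -- The common side of `X` makes the term `rise s` the same in both insertions, so it cancels.
  ... | inj₁ Y⟶X = +-cancelˡ-≡ (rise s) _ _ (begin
    rise s + (a₁ + m₂)  ≡⟨ +-assoc (rise s) a₁ m₂ ⟨
    rise s + a₁ + m₂    ≡⟨ cong (_+ m₂) (Insertion.arrow-to-X I₁ Y-at X-at₁ Y⟶X) ⟨
    b + m₁ + m₂         ≡⟨ xy∙z≈xz∙y b m₁ m₂ ⟩
    b + m₂ + m₁         ≡⟨ cong (_+ m₁) (Insertion.arrow-to-X I₂ Y-at X-at₂ Y⟶X) ⟩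
    rise s + a₂ + m₁    ≡⟨ +-assoc (rise s) a₂ m₁ ⟩
    rise s + (a₂ + m₁)  ∎)
    where
    open ≡-Reasoning
    m₁ = Insertion.shift I₁
    m₂ = Insertion.shift I₂
  ... | inj₂ X⟶Y = begin
    a₁ + m₂               ≡⟨ cong (_+ m₂) (Insertion.arrow-from-X I₁ Y-at X-at₁ X⟶Y) ⟩
    rise t + b + m₁ + m₂  ≡⟨ xy∙z≈xz∙y (rise t + b) m₁ m₂ ⟩
    rise t + b + m₂ + m₁  ≡⟨ cong (_+ m₁) (Insertion.arrow-from-X I₂ Y-at X-at₂ X⟶Y) ⟨
    a₂ + m₁               ∎
    where
    open ≡-Reasoning
    m₁ = Insertion.shift I₁
    m₂ = Insertion.shift I₂

  same-side⇒same-layers : IsBoundary G (PLD.Vars D) X →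
    (I₁ I₂ : Insertion X D) → ∀ {s a₁ a₂} →
    Placed (Insertion.layers I₁) X s a₁ → Placed (Insertion.layers I₂) X s a₂ →
    Insertion.layers I₁ ≡ Insertion.layers I₂
  same-side⇒same-layers boundary I₁ I₂ {s} {a₁} {a₂} X-at₁ X-at₂ =
    ≼-antisym (Insertion.decomposition I₁) (Insertion.decomposition I₂)
      (placement-determines-≼ I₁ I₂ m₁≡m₂ X-at₁ X-at₂′)
      (placement-determines-≼ I₂ I₁ (sym m₁≡m₂) X-at₂′ X-at₁)
    where
    m₁ = Insertion.shift I₁
    m₂ = Insertion.shift I₂
    offsets : a₁ + m₂ ≡ a₂ + m₁
    offsets = same-side⇒same-offset boundary I₁ I₂ X-at₁ X-at₂
    m₁≡m₂ : m₁ ≡ m₂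
    m₁≡m₂ = equal-shifts offsets (Insertion.unshifted-or-X-bottom I₁ X-at₁)
                                 (Insertion.unshifted-or-X-bottom I₂ X-at₂)
    X-at₂′ : Placed (Insertion.layers I₂) X s a₁
    X-at₂′ = subst (Placed (Insertion.layers I₂) X s)
      -- Once the shifts agree, equal offsets give equal absolute positions.
      (sym (+-cancelʳ-≡ m₂ a₁ a₂ (trans offsets (cong (a₂ +_) m₁≡m₂)))) X-at₂

  at-most-two : IsBoundary G (PLD.Vars D) X → (I₁ I₂ I₃ : Insertion X D) →
    Insertion.layers I₁ ≡ Insertion.layers I₂ ⊎
    Insertion.layers I₁ ≡ Insertion.layers I₃ ⊎
    Insertion.layers I₂ ≡ Insertion.layers I₃
  at-most-two boundary I₁ I₂ I₃
    with s₁ , _ , X-at₁ ← Insertion.Placed-X I₁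
    with s₂ , _ , X-at₂ ← Insertion.Placed-X I₂
    with s₃ , _ , X-at₃ ← Insertion.Placed-X I₃
    with side-pigeonhole s₁ s₂ s₃
  ... | inj₁ refl        = inj₁ (same-side⇒same-layers boundary I₁ I₂ X-at₁ X-at₂)
  ... | inj₂ (inj₁ refl) = inj₂ (inj₁ (same-side⇒same-layers boundary I₁ I₃ X-at₁ X-at₃))
  ... | inj₂ (inj₂ refl) = inj₂ (inj₂ (same-side⇒same-layers boundary I₂ I₃ X-at₂ X-at₃))

theorem3 : ∀ {n : ℕ} (G : DAG n) (D : PLD G) (X : Fin n) →
    IsBoundary G (PLD.Vars D) X →
    (D₁ D₂ D₃ : PLD G) →
    IsInsertion X D D₁ → IsInsertion X D D₂ → IsInsertion X D D₃ →
    PLD.layers D₁ ≡ PLD.layers D₂ ⊎ PLD.layers D₁ ≡ PLD.layers D₃ ⊎ PLD.layers D₂ ≡ PLD.layers D₃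
theorem3 G D X boundary D₁ D₂ D₃ I₁ I₂ I₃ =
  at-most-two {D = D} boundary (insertion D₁ I₁) (insertion D₂ I₂) (insertion D₃ I₃)
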